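{- Let $S_r$ be a nonempty finite collection of points in $\mathbb{R}^d$ (the reference set), let $S_q$ be a finite collection of points in $\mathbb{R}^d$ (the query set), let $0 < \epsilon < 1$, and let $m > 0$ be any integer (the table size). Run the algorithm GuaranteedDrusillaHash (defined in the context) on the input $(S_r, S_q, \epsilon, m)$ with number of neighbors $k = 1$. Then for each query point $p_q \in S_q$, the algorithm returns a point $\hat{p}_{fn} \in S_r$ such that, with $p_{fn}$ a true furthest neighbor of $p_q$ in $S_r$ and provided $d(p_q, p_{fn}) > 0$ (so that the ratio is meaningful), $$\frac{d(p_q, p_{fn})}{d(p_q, \hat{p}_{fn})} < 1 + \epsilon .$$ That is, $\hat{p}_{fn}$ is an $\epsilon$-approximate furthest neighbor of $p_q$.
   Context: Throughout, $\|\cdot\|$ is the Euclidean norm on $\mathbb{R}^d$ and $d(x,y) = \|x-y\|$. A true furthest neighbor of $p_q$ in $S_r$ is a point $p_{fn} \in \operatorname{argmax}_{p_r \in S_r} d(p_q, p_r)$. Algorithm GuaranteedDrusillaHash (with $k=1$). Input: reference set $S_r$ with $n$ points, query set $S_q$, approximation level $\epsilon$, table size $m$. Ties in any argmax, and in the choice of points with largest score, are broken arbitrarily. 1. Centering. Let $\mu = \frac{1}{n}\sum_{p_r \in S_r} p_r$. Replace every $p_r \in S_r$ by $p_r - \mu$ and every $p_q \in S_q$ by $p_q - \mu$. (Distances between points are unaffected; a returned point is identified with the corresponding original point of $S_r$.) Below, all points are the centered ones. Put $\delta = \epsilon/15$ and $M = \max_{p_r \in S_r}\|p_r\|$. Initially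 all points of $S_r$ are marked unused. 2. Building tables. For $i = 0, 1, 2, \ldots$, while there is an unused point $p_r \in S_r$ with $\|p_r\| > \delta M$, do the following: (a) let $p_i$ be an unused point of $S_r$ of largest norm, and let $v_i = p_i/\|p_i\|$; (b) for every unused $p_r \in S_r$ compute the offset $O[p_r] = p_r^T v_i$, the distortion $D[p_r] = \|p_r - O[p_r] v_i\|$, and the score $s[p_r] = |O[p_r]| - D[p_r]$; (c) let the table $R_i$ consist of the $m$ unused points with largest scores $s[\cdot]$ (all unused points if fewer than $m$ remain), and mark all points in $R_i$ as used. 3. Shrug point. If some point of $S_r$ is still unused when the loop ends, let $p_{sh}$ be an arbitrary such point (it has norm at most $\delta M$); otherwise there is no shrug point. 4. Search. For each $p_q \in S_q$, return as $\hat{p}_{fn}$ a point maximizing $d(p_q, \cdot)$ over all points contained in the tables $R_i$ together with $p_{sh}$ (if it exists). -}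

module Defs where

open import Algebra.Bundles using (CommutativeRing)
import Algebra.Construct.NaturalChoice.Max as NaturalMax
import Algebra.Definitions.RawMonoid as RawMonoidOps
open import Data.Fin.Base using (Fin)
open import Data.Fin.Subset using (Subset; _∈_; _∉_; _⊆_; _─_; ⊤; Empty; ∣_∣)
open import Data.List.Base using (List; []; _∷_; tabulate)
import Data.List.Extrema as Extrema
open import Data.List.Relation.Unary.Any using (Any)
open import Data.Maybe.Base using (Maybe; just; nothing)
open import Data.Nat.Base as ℕ using (ℕ)
open import Data.Product.Base using (∃; _×_)
open import Data.Sum.Base using (_⊎_)
open import Data.Vec.Functional using (Vector)
open import Level using (Level; _⊔_; suc)
open import Relation.Binary.Bundles using (StrictTotalOrder; TotalOrder)
open import Relation.Binary.Core using (Rel)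
import Relation.Binary.Properties.StrictTotalOrder as StrictTotalOrderProperties
open import Relation.Binary.Structures using (IsStrictTotalOrder)
open import Relation.Binary.PropositionalEquality.Core using (_≡_)
open import Relation.Nullary.Negation.Core using (¬_)
open import Relation.Unary using (Pred; Satisfiable)

-- The real numbers, axiomatised classically as a Dedekind-complete ordered
-- field; these axioms determine the structure up to isomorphism.
-- Inversion is a total operation whose value at 0# is unspecified, and √ is
-- unspecified on negative arguments.  The square root of a non-negative
-- element exists by completeness and is unique, so carrying √ as a field
-- excludes no complete ordered field.
record RealNumbers (c ℓ : Level) : Set (suc (c ⊔ ℓ)) where
  field
    commutativeRing : CommutativeRing c ℓ

  open CommutativeRing commutativeRing public

  infix  4 _<_
  infixl 7 _/_
  infix  8 _⁻¹

  field
    _<_                : Rel Carrier ℓ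
    isStrictTotalOrder : IsStrictTotalOrder _≈_ _<_
    0<1                : 0# < 1#
    +-monoˡ-<          : ∀ {x y} z → x < y → x + z < y + z
    *-pos              : ∀ {x y} → 0# < x → 0# < y → 0# < x * y
    _⁻¹                : Carrier → Carrier
    ⁻¹-cong            : ∀ {x y} → x ≈ y → x ⁻¹ ≈ y ⁻¹
    *-inverseʳ         : ∀ {x} → ¬ (x ≈ 0#) → x * x ⁻¹ ≈ 1#

  strictTotalOrder : StrictTotalOrder c ℓ ℓ
  strictTotalOrder = record { isStrictTotalOrder = isStrictTotalOrder }

  open StrictTotalOrderProperties strictTotalOrder public
    using (_≤_; decTotalOrder; totalOrder)

  IsUpperBound : Pred Carrier ℓ → Pred Carrier (c ⊔ ℓ)
  IsUpperBound P b = ∀ {x} → P x → x ≤ b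

  field
    complete : (P : Pred Carrier ℓ) → Satisfiable P → Satisfiable (IsUpperBound P) →
               ∃ λ s → IsUpperBound P s × (∀ {b} → IsUpperBound P b → s ≤ b)
    √_       : Carrier → Carrier
    √-cong   : ∀ {x y} → x ≈ y → √ x ≈ √ y
    √-nonneg : ∀ {x} → 0# ≤ x → 0# ≤ √ x
    √-square : ∀ {x} → 0# ≤ x → √ x * √ x ≈ x

  open RawMonoidOps +-rawMonoid public using (sum)

  _/_ : Carrier → Carrier → Carrier
  x / y = x * y ⁻¹

  fromℕ : ℕ → Carrier
  fromℕ k = RawMonoidOps._×_ +-rawMonoid k 1#

  abs : Carrier → Carrier
  abs x = NaturalMax._⊔_ totalOrder x (- x)

  IsArgmax : ∀ {a p} {A : Set a} → (A → Carrier) → Pred A p → Pred A (a ⊔ p ⊔ ℓ)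
  IsArgmax f P x = P x × (∀ y → P y → f y ≤ f x)

module Euclidean {c ℓ : Level} (ℝ : RealNumbers c ℓ) where
  open RealNumbers ℝ

  Point : ℕ → Set c
  Point d = Vector Carrier d

  infixl 6 _−_
  infixr 7 _•_

  _−_ : ∀ {d} → Point d → Point d → Point d
  (x − y) i = x i - y i

  _•_ : ∀ {d} → Carrier → Point d → Point d
  (a • x) i = a * x i

  ⟨_,_⟩ : ∀ {d} → Point d → Point d → Carrier
  ⟨ x , y ⟩ = sum (λ i → x i * y i)

  ‖_‖ : ∀ {d} → Point d → Carrier
  ‖ x ‖ = √ ⟨ x , x ⟩

  dist : ∀ {d} → Point d → Point d → Carrier
  dist x y = ‖ x − y ‖

  mean : ∀ {d n} → (Fin n → Point d) → Point d
  mean {n = n} p i = sum (λ r → p r i) / fromℕ n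

  -- A collection of points is an indexed family, and its members are referred
  -- to by index, so repeated points are allowed.
  IsFurthestNeighbour : ∀ {d n} → Point d → (Fin n → Point d) → Pred (Fin n) ℓ
  IsFurthestNeighbour q p fn = ∀ r → dist q (p r) ≤ dist q (p fn)

-- Since ties are broken arbitrarily, the algorithm is given as a relation:
-- an Execution is any sequence of choices it may make on the given input.
module GuaranteedDrusillaHash
  {c ℓ : Level} (ℝ : RealNumbers c ℓ) {d n q : ℕ}
  (Sᵣ : Fin n → Vector (RealNumbers.Carrier ℝ) d)
  (S_q : Fin q → Vector (RealNumbers.Carrier ℝ) d)
  (ε : RealNumbers.Carrier ℝ) (m : ℕ)
  where

  open RealNumbers ℝ
  open Euclidean ℝ

  reference : Fin n → Point d
  reference r = Sᵣ r − mean Sᵣ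

  query : Fin q → Point d
  query j = S_q j − mean Sᵣ

  δ : Carrier
  δ = ε / fromℕ 15

  -- The base value 0# is harmless because norms are non-negative.
  M : Carrier
  M = Extrema.max totalOrder 0# (tabulate (λ r → ‖ reference r ‖))

  direction : Fin n → Point d
  direction i = (‖ reference i ‖ ⁻¹) • reference i

  offset : Point d → Fin n → Carrier
  offset v r = ⟨ reference r , v ⟩

  distortion : Point d → Fin n → Carrier
  distortion v r = ‖ reference r − offset v r • v ‖

  score : Point d → Fin n → Carrier
  score v r = abs (offset v r) - distortion v r

  LoopCondition : Subset n → Set ℓ
  LoopCondition unused = ∃ λ r → r ∈ unused × δ * M < ‖ reference r ‖

  record IsTable (unused R : Subset n) : Set ℓ where
    field
      base    : Fin n
      largest : IsArgmax (λ r → ‖ reference r ‖) (_∈ unused) base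
      R⊆      : R ⊆ unused
      size    : ∣ R ∣ ≡ m ℕ.⊓ ∣ unused ∣
      top     : ∀ {r s} → r ∈ R → s ∈ unused → s ∉ R →
                score (direction base) s ≤ score (direction base) r

  -- Loop U Rs L: started with U unused, the loop ends after building the
  -- tables Rs, with L still unused.
  data Loop : Subset n → List (Subset n) → Subset n → Set ℓ where
    stop : ∀ {U} → ¬ LoopCondition U → Loop U [] U
    step : ∀ {U R Rs L} → LoopCondition U → IsTable U R →
           Loop (U ─ R) Rs L → Loop U (R ∷ Rs) L

  data IsShrugPoint (leftover : Subset n) : Maybe (Fin n) → Set where
    none : Empty leftover → IsShrugPoint leftover nothing
    some : ∀ {r} → r ∈ leftover → IsShrugPoint leftover (just r)

  record Execution : Set (c ⊔ ℓ) where
    field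
      tables   : List (Subset n)
      leftover : Subset n
      loop     : Loop ⊤ tables leftover
      shrug    : Maybe (Fin n)
      isShrug  : IsShrugPoint leftover shrug

    Candidate : Fin n → Set
    Candidate r = Any (r ∈_) tables ⊎ shrug ≡ just r

    field
      result : Fin q → Fin n
      search : ∀ j → IsArgmax (λ r → dist (query j) (reference r)) Candidate (result j)

{-# OPTIONS --safe #-}
-- Every point ends up either in a table or left over with norm at most δM.  Only
-- a left over furthest neighbour fn needs an argument.  Then there is a shrug
-- point p_sh, and with D = d(q, result) the triangle inequality through p_sh and
-- the origin gives d(q, fn) ≤ D + 2δM.  A point of norm M is either left over or
-- at distance at most D from q, so through q and p_sh one gets M ≤ 2D + δM.
-- Together these give d(q, fn) ≤ (1 + 2ε/7) D.  The mean, the directions and the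
-- scores play no role, except that an execution has to exist.
module Submission where

open import Defs
import Algebra.Properties.AbelianGroup as AbelianGroupProperties
import Algebra.Properties.Monoid.Mult as MonoidMult
import Algebra.Properties.Ring as RingProperties
import Algebra.Properties.Semiring.Sum as SemiringSum
import Algebra.Solver.Ring.NaturalCoefficients.Default as NaturalSolver
open import Data.Fin.Base using (Fin; zero; suc; fromℕ<)
open import Data.Fin.Properties using (any?; _≟_)
open import Data.Fin.Subset
  using (Subset; inside; outside; _∈_; _∉_; _⊆_; _─_; _∪_; _∩_; ⁅_⁆; ⊤; ⊥; Nonempty; ∣_∣)
open import Data.Fin.Subset.Properties
  using (_∈?_; nonempty?; ∈⊤; ∉⊥; ∣⊥∣≡0; x∈⁅y⁆⇒x≡y; ∪-identityˡ; q⊆p∪q; x∈p∪q⁻; x∈p∩q⁺;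
         p⊆q⇒∣p∣≤∣q∣; x∈p∧x∉q⇒x∈p─q; p∩q≢∅⇒∣p─q∣<∣p∣; x∈p⇒∣p-x∣<∣p∣)
open import Data.List.Base using (List; []; _∷_; allFin; filter; tabulate)
import Data.List.Extrema as Extrema
open import Data.List.Membership.Propositional.Properties using (∈-filter⁺; ∈-allFin)
open import Data.List.Relation.Unary.All using (lookup)
open import Data.List.Relation.Unary.All.Properties using (all-filter; tabulate⁺)
open import Data.List.Relation.Unary.Any as Any using (Any; here; there)
open import Data.Maybe.Base using (just; nothing)
open import Data.Maybe.Properties using (≡-dec)
open import Data.Nat.Base as ℕ using (ℕ; NonZero)
open import Data.Nat.Induction using (<-wellFounded)
import Data.Nat.Properties as ℕ
open import Data.Product.Base using (_×_; _,_; proj₁; proj₂; ∃)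
open import Data.Sum.Base using (_⊎_; inj₁; inj₂; map₁)
open import Data.Vec.Base using (_∷_; here; there)
open import Function.Base using (_∘_)
open import Induction.WellFounded using (Acc; acc)
open import Relation.Binary.Bundles using (StrictTotalOrder)
open import Relation.Binary.Definitions using (tri<; tri≈; tri>)
open import Relation.Binary.PropositionalEquality.Core using (_≡_; cong; subst₂) renaming (refl to ≡-refl; sym to ≡-sym)
import Relation.Binary.Reasoning.StrictPartialOrder as StrictReasoning
open import Relation.Nullary.Decidable using (Dec; yes; no; ¬?; _×-dec_; _⊎-dec_; decidable-stable)
open import Relation.Nullary.Negation.Core using (¬_; contradiction)
open import Relation.Unary using (Pred; Decidable; Satisfiable)

-- Ordered field arithmetic, ending with the numerical estimate behind the ratio.

module OrderedFieldProperties {c ℓ} (ℝ : RealNumbers c ℓ) where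
  open RealNumbers ℝ
  open StrictTotalOrder strictTotalOrder public
    using (strictPartialOrder; _<?_)
  open StrictTotalOrder strictTotalOrder
    using (compare) renaming (irrefl to <-irrefl; asym to <-asym)
  open RingProperties ring using (-‿distribˡ-*; -‿distribʳ-*; -‿involutive)
  open StrictReasoning strictPartialOrder
  open NaturalSolver commutativeSemiring using (solve; _:=_; _:+_; _:*_; con)
  open MonoidMult +-monoid using (×-homo-+)

  <⇒≤ : ∀ {x y} → x < y → x ≤ y
  <⇒≤ = inj₁

  ≤-reflexive : ∀ {x y} → x ≈ y → x ≤ y
  ≤-reflexive = inj₂

  ≤-trans : ∀ {x y z} → x ≤ y → y ≤ z → x ≤ z
  ≤-trans {x} {y} {z} x≤y y≤z = begin
    x ≤⟨ x≤y ⟩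
    y ≤⟨ y≤z ⟩
    z ∎

  ≮⇒≥ : ∀ {x y} → ¬ (x < y) → y ≤ x
  ≮⇒≥ {x} {y} x≮y with compare x y
  ... | tri< x<y _ _ = contradiction x<y x≮y
  ... | tri≈ _ x≈y _ = inj₂ (sym x≈y)
  ... | tri> _ _ y<x = inj₁ y<x

  ≰⇒> : ∀ {x y} → ¬ (x ≤ y) → y < x
  ≰⇒> {x} {y} x≰y with compare x y
  ... | tri< x<y _ _ = contradiction (inj₁ x<y) x≰y
  ... | tri≈ _ x≈y _ = contradiction (inj₂ x≈y) x≰y
  ... | tri> _ _ y<x = y<x

  <⇒≱ : ∀ {x y} → x < y → ¬ (y ≤ x)
  <⇒≱ x<y (inj₁ y<x) = <-asym x<y y<x
  <⇒≱ x<y (inj₂ y≈x) = <-irrefl (sym y≈x) x<y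

  +-monoˡ-≤ : ∀ {x y} z → x ≤ y → x + z ≤ y + z
  +-monoˡ-≤ z (inj₁ x<y) = inj₁ (+-monoˡ-< z x<y)
  +-monoˡ-≤ z (inj₂ x≈y) = inj₂ (+-congʳ x≈y)

  +-monoʳ-≤ : ∀ {x y} z → x ≤ y → z + x ≤ z + y
  +-monoʳ-≤ {x} {y} z x≤y = begin
    z + x ≈⟨ +-comm z x ⟩
    x + z ≤⟨ +-monoˡ-≤ z x≤y ⟩
    y + z ≈⟨ +-comm y z ⟩
    z + y ∎

  +-monoʳ-< : ∀ {x y} z → x < y → z + x < z + y
  +-monoʳ-< {x} {y} z x<y = begin-strict
    z + x ≈⟨ +-comm z x ⟩
    x + z <⟨ +-monoˡ-< z x<y ⟩
    y + z ≈⟨ +-comm y z ⟩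
    z + y ∎

  +-mono-≤ : ∀ {x y u v} → x ≤ y → u ≤ v → x + u ≤ y + v
  +-mono-≤ x≤y u≤v = ≤-trans (+-monoˡ-≤ _ x≤y) (+-monoʳ-≤ _ u≤v)

  +-nonneg : ∀ {x y} → 0# ≤ x → 0# ≤ y → 0# ≤ x + y
  +-nonneg {x} {y} 0≤x 0≤y = begin
    0#      ≈⟨ +-identityʳ 0# ⟨
    0# + 0# ≤⟨ +-mono-≤ 0≤x 0≤y ⟩
    x + y   ∎

  +-cancelʳ-≤ : ∀ {x y} z → x + z ≤ y + z → x ≤ y
  +-cancelʳ-≤ z x+z≤y+z = ≮⇒≥ λ y<x → <⇒≱ (+-monoˡ-< z y<x) x+z≤y+z

  x≤y⇒0≤y-x : ∀ {x y} → x ≤ y → 0# ≤ y - x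
  x≤y⇒0≤y-x {x} {y} x≤y = begin
    0#    ≈⟨ -‿inverseʳ x ⟨
    x - x ≤⟨ +-monoˡ-≤ (- x) x≤y ⟩
    y - x ∎

  x<y⇒0<y-x : ∀ {x y} → x < y → 0# < y - x
  x<y⇒0<y-x {x} {y} x<y = begin-strict
    0#    ≈⟨ -‿inverseʳ x ⟨
    x - x <⟨ +-monoˡ-< (- x) x<y ⟩
    y - x ∎

  x+[y-x]≈y : ∀ x y → x + (y - x) ≈ y
  x+[y-x]≈y x y = begin-equality
    x + (y - x)   ≈⟨ +-congˡ (+-comm y (- x)) ⟩
    x + (- x + y) ≈⟨ +-assoc x (- x) y ⟨
    x - x + y     ≈⟨ +-congʳ (-‿inverseʳ x) ⟩
    0# + y        ≈⟨ +-identityˡ y ⟩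
    y             ∎

  *-nonneg : ∀ {x y} → 0# ≤ x → 0# ≤ y → 0# ≤ x * y
  *-nonneg {x} {y} (inj₁ 0<x) (inj₁ 0<y) = inj₁ (*-pos 0<x 0<y)
  *-nonneg {x} {y} (inj₂ 0≈x) _          = inj₂ (trans (sym (zeroˡ y)) (*-congʳ 0≈x))
  *-nonneg {x} {y} _          (inj₂ 0≈y) = inj₂ (trans (sym (zeroʳ x)) (*-congˡ 0≈y))

  *-monoʳ-≤ : ∀ {x y z} → 0# ≤ z → x ≤ y → z * x ≤ z * y
  *-monoʳ-≤ {x} {y} {z} 0≤z x≤y = begin
    z * x                 ≈⟨ +-identityʳ (z * x) ⟨
    z * x + 0#            ≤⟨ +-monoʳ-≤ (z * x) (*-nonneg 0≤z (x≤y⇒0≤y-x x≤y)) ⟩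
    z * x + z * (y - x)   ≈⟨ distribˡ z x (y - x) ⟨
    z * (x + (y - x))     ≈⟨ *-congˡ (x+[y-x]≈y x y) ⟩
    z * y                 ∎

  *-monoʳ-< : ∀ {x y z} → 0# < z → x < y → z * x < z * y
  *-monoʳ-< {x} {y} {z} 0<z x<y = begin-strict
    z * x                 ≈⟨ +-identityʳ (z * x) ⟨
    z * x + 0#            <⟨ +-monoʳ-< (z * x) (*-pos 0<z (x<y⇒0<y-x x<y)) ⟩
    z * x + z * (y - x)   ≈⟨ distribˡ z x (y - x) ⟨
    z * (x + (y - x))     ≈⟨ *-congˡ (x+[y-x]≈y x y) ⟩
    z * y                 ∎

  *-monoˡ-≤ : ∀ {x y z} → 0# ≤ z → x ≤ y → x * z ≤ y * z
  *-monoˡ-≤ {x} {y} {z} 0≤z x≤y = begin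
    x * z ≈⟨ *-comm x z ⟩
    z * x ≤⟨ *-monoʳ-≤ 0≤z x≤y ⟩
    z * y ≈⟨ *-comm z y ⟩
    y * z ∎

  -x*-x≈x*x : ∀ x → - x * - x ≈ x * x
  -x*-x≈x*x x = begin-equality
    - x * - x     ≈⟨ -‿distribˡ-* x (- x) ⟨
    - (x * - x)   ≈⟨ -‿cong (-‿distribʳ-* x x) ⟨
    - - (x * x)   ≈⟨ -‿involutive (x * x) ⟩
    x * x         ∎

  square-nonneg : ∀ x → 0# ≤ x * x
  square-nonneg x with compare 0# x
  ... | tri< 0<x _ _ = inj₁ (*-pos 0<x 0<x)
  ... | tri≈ _ 0≈x _ = *-nonneg (inj₂ 0≈x) (inj₂ 0≈x)
  ... | tri> _ _ x<0 = begin
    0#            ≤⟨ *-nonneg 0≤-x 0≤-x ⟩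
    - x * - x     ≈⟨ -x*-x≈x*x x ⟩
    x * x         ∎
    where
    0≤-x : 0# ≤ - x
    0≤-x = ≤-trans (x≤y⇒0≤y-x (<⇒≤ x<0)) (≤-reflexive (+-identityˡ (- x)))

  -- Removes square roots from inequalities between norms. If y < x, then x is positive and
  -- multiplication by it is strictly monotone, so y * y ≤ x * y < x * x.
  square-cancel-≤ : ∀ {x y} → 0# ≤ y → x * x ≤ y * y → x ≤ y
  square-cancel-≤ {x} {y} 0≤y x²≤y² = ≮⇒≥ λ y<x → <⇒≱ (y²<x² y<x) x²≤y²
    where
    y²<x² : y < x → y * y < x * x
    y²<x² y<x = begin-strict
      y * y ≤⟨ *-monoˡ-≤ 0≤y (<⇒≤ y<x) ⟩
      x * y <⟨ *-monoʳ-< 0<x y<x ⟩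
      x * x ∎
      where
      0<x : 0# < x
      0<x = begin-strict
        0# ≤⟨ 0≤y ⟩
        y  <⟨ y<x ⟩
        x  ∎

  -- With y ≈ x + t the difference of the two sides is t * t.
  2xy≤x²+y² : ∀ x y → x * y + x * y ≤ x * x + y * y
  2xy≤x²+y² x y = begin
    x * y + x * y                       ≈⟨ +-cong (*-congˡ y≈) (*-congˡ y≈) ⟨
    x * (x + t) + x * (x + t)           ≈⟨ +-identityʳ _ ⟨
    x * (x + t) + x * (x + t) + 0#      ≤⟨ +-monoʳ-≤ _ (square-nonneg t) ⟩
    x * (x + t) + x * (x + t) + t * t   ≈⟨ solve 2 (λ x t → x :* (x :+ t) :+ x :* (x :+ t) :+ t :* t := x :* x :+ (x :+ t) :* (x :+ t)) refl x t ⟩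
    x * x + (x + t) * (x + t)           ≈⟨ +-congˡ (*-cong y≈ y≈) ⟩
    x * x + y * y                       ∎
    where
    t = y - x
    y≈ = x+[y-x]≈y x y

  fromℕ-nonneg : ∀ k → 0# ≤ fromℕ k
  fromℕ-nonneg ℕ.zero    = inj₂ refl
  fromℕ-nonneg (ℕ.suc k) = +-nonneg (inj₁ 0<1) (fromℕ-nonneg k)

  fromℕ-pos : ∀ k .{{_ : NonZero k}} → 0# < fromℕ k
  fromℕ-pos (ℕ.suc k) = begin-strict
    0#           <⟨ 0<1 ⟩
    1#           ≈⟨ +-identityʳ 1# ⟨
    1# + 0#      ≤⟨ +-monoʳ-≤ 1# (fromℕ-nonneg k) ⟩
    1# + fromℕ k ∎

  pos⇒≉0 : ∀ {x} → 0# < x → ¬ (x ≈ 0#)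
  pos⇒≉0 0<x x≈0 = <-irrefl (sym x≈0) 0<x

  x/y*y≈x : ∀ x {y} → 0# < y → x / y * y ≈ x
  x/y*y≈x x {y} 0<y = begin-equality
    x * y ⁻¹ * y    ≈⟨ *-assoc x (y ⁻¹) y ⟩
    x * (y ⁻¹ * y)  ≈⟨ *-congˡ (*-comm (y ⁻¹) y) ⟩
    x * (y * y ⁻¹)  ≈⟨ *-congˡ (*-inverseʳ (pos⇒≉0 0<y)) ⟩
    x * 1#          ≈⟨ *-identityʳ x ⟩
    x               ∎

  -- Argued by contradiction, multiplying back by y, so that the sign of `y ⁻¹` never has to be
  -- determined.
  x<z*y⇒x/y<z : ∀ {x y z} → 0# < y → x < z * y → x / y < z
  x<z*y⇒x/y<z {x} {y} {z} 0<y x<zy = ≰⇒> λ z≤x/y → <⇒≱ x<zy (begin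
    z * y     ≤⟨ *-monoˡ-≤ (<⇒≤ 0<y) z≤x/y ⟩
    x / y * y ≈⟨ x/y*y≈x x 0<y ⟩
    x         ∎)

  -- Only 15 δ = ε is used about δ: the hypotheses give 14 M ≤ 30 D, hence
  -- 7 x ≤ (7 + 2 ε) D.
  ratio-arithmetic : ∀ {ε M D x} → 0# < ε → ε < 1# → 0# ≤ M → 0# < x →
    let δ = ε / fromℕ 15 in
    M ≤ D + D + δ * M → x ≤ D + (δ * M + δ * M) → 0# < D × x < (1# + ε) * D
  ratio-arithmetic {ε} {M} {D} {x} 0<ε ε<1 0≤M 0<x M≤ x≤ = 0<D , x<
    where
    δ = ε / fromℕ 15
    k = fromℕ 15
    e = fromℕ 14
    h = fromℕ 7

    0<k : 0# < k
    0<k = fromℕ-pos 15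

    0<h : 0# < h
    0<h = fromℕ-pos 7

    δk≈ε : δ * k ≈ ε
    δk≈ε = x/y*y≈x ε 0<k

    0≤δ : 0# ≤ δ
    0≤δ = ≮⇒≥ λ δ<0 → <⇒≱ 0<ε (begin
      ε      ≈⟨ δk≈ε ⟨
      δ * k  ≤⟨ *-monoˡ-≤ (<⇒≤ 0<k) (<⇒≤ δ<0) ⟩
      0# * k ≈⟨ zeroˡ k ⟩
      0#     ∎)

    -- Multiplying the bound on M by 15 turns δ * M into ε * M, which is at most M. One of the 15
    -- copies of M on the left absorbs it, leaving 14. The numeral `fromℕ 15` unfolds to
    -- `1# + fromℕ 14`, hence `con 1 :+ e`.
    eM≤kDD : e * M ≤ k * (D + D)
    eM≤kDD = +-cancelʳ-≤ M (begin
      e * M + M                  ≈⟨ solve 2 (λ e m → e :* m :+ m := (con 1 :+ e) :* m) refl e M ⟩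
      k * M                      ≤⟨ *-monoʳ-≤ (<⇒≤ 0<k) M≤ ⟩
      k * (D + D + δ * M)        ≈⟨ solve 4 (λ k d δ m → k :* (d :+ d :+ δ :* m) := k :* (d :+ d) :+ δ :* k :* m) refl k D δ M ⟩
      k * (D + D) + δ * k * M    ≈⟨ +-congˡ (*-congʳ δk≈ε) ⟩
      k * (D + D) + ε * M        ≤⟨ +-monoʳ-≤ _ (*-monoˡ-≤ 0≤M (<⇒≤ ε<1)) ⟩
      k * (D + D) + 1# * M       ≈⟨ +-congˡ (*-identityˡ M) ⟩
      k * (D + D) + M            ∎)

    g = h + (ε + ε)

    -- The factor 7 makes the two copies of δ * M into 14 of them, so that `eM≤kDD` applies. The
    -- factor 15 it brings in then cancels against δ.
    hx≤gD : h * x ≤ g * D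
    hx≤gD = begin
      h * x                         ≤⟨ *-monoʳ-≤ (<⇒≤ 0<h) x≤ ⟩
      h * (D + (δ * M + δ * M))     ≈⟨ solve 4 (λ h d δ m → h :* (d :+ (δ :* m :+ δ :* m)) := h :* d :+ δ :* ((h :+ h) :* m)) refl h D δ M ⟩
      h * D + δ * ((h + h) * M)     ≈⟨ +-congˡ (*-congˡ (*-congʳ (×-homo-+ 1# 7 7))) ⟨
      h * D + δ * (e * M)           ≤⟨ +-monoʳ-≤ _ (*-monoʳ-≤ 0≤δ eM≤kDD) ⟩
      h * D + δ * (k * (D + D))     ≈⟨ +-congˡ (*-assoc δ k (D + D)) ⟨
      h * D + δ * k * (D + D)       ≈⟨ +-congˡ (*-congʳ δk≈ε) ⟩
      h * D + ε * (D + D)           ≈⟨ solve 3 (λ h ε d → h :* d :+ ε :* (d :+ d) := (h :+ (ε :+ ε)) :* d) refl h ε D ⟩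
      g * D                         ∎

    0≤g : 0# ≤ g
    0≤g = +-nonneg (<⇒≤ 0<h) (+-nonneg (<⇒≤ 0<ε) (<⇒≤ 0<ε))

    -- If D were not positive, g * D would not be either, although it bounds the positive h * x.
    0<D : 0# < D
    0<D = ≰⇒> λ D≤0 → <⇒≱ (*-pos 0<h 0<x) (begin
      h * x   ≤⟨ hx≤gD ⟩
      g * D   ≤⟨ *-monoʳ-≤ 0≤g D≤0 ⟩
      g * 0#  ≈⟨ zeroʳ g ⟩
      0#      ∎)

    -- The surplus of 7 (1 + ε) over g = 7 + 2 ε is 5 ε. Multiplied by the positive D, it makes the
    -- inequality strict.
    f = fromℕ 5

    x< : x < (1# + ε) * D
    x< = ≰⇒> λ ≤x → <⇒≱ (begin-strict
      g * D                      ≈⟨ +-identityʳ _ ⟨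
      g * D + 0#                 <⟨ +-monoʳ-< _ (*-pos (*-pos (fromℕ-pos 5) 0<ε) 0<D) ⟩
      g * D + f * ε * D          ≈⟨ solve 3 (λ f ε d →
                                      (con 1 :+ (con 1 :+ f) :+ (ε :+ ε)) :* d :+ f :* ε :* d
                                      := (con 1 :+ (con 1 :+ f)) :* ((con 1 :+ ε) :* d)) refl f ε D ⟩
      h * ((1# + ε) * D)         ≤⟨ *-monoʳ-≤ (<⇒≤ 0<h) ≤x ⟩
      h * x                      ∎) hx≤gD

-- Euclidean geometry: Cauchy-Schwarz, the triangle inequality and translation.

module EuclideanProperties {c ℓ} (ℝ : RealNumbers c ℓ) where
  open RealNumbers ℝ hiding (zero)
  open Euclidean ℝ
  open OrderedFieldProperties ℝ
  open RingProperties ring using (-0#≈0#)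
  open AbelianGroupProperties +-abelianGroup using (⁻¹-anti-homo‿-)
  open SemiringSum semiring using (sum-cong-≋)
  open StrictReasoning strictPartialOrder
  open NaturalSolver commutativeSemiring using (solve; _:=_; _:+_; _:*_)

  ⟨x,x⟩-nonneg : ∀ {d} (x : Point d) → 0# ≤ ⟨ x , x ⟩
  ⟨x,x⟩-nonneg {ℕ.zero}  x = inj₂ refl
  ⟨x,x⟩-nonneg {ℕ.suc d} x = +-nonneg (square-nonneg (x zero)) (⟨x,x⟩-nonneg (x ∘ suc))

  ‖x‖-nonneg : ∀ {d} (x : Point d) → 0# ≤ ‖ x ‖
  ‖x‖-nonneg x = √-nonneg (⟨x,x⟩-nonneg x)

  ‖x‖²≈⟨x,x⟩ : ∀ {d} (x : Point d) → ‖ x ‖ * ‖ x ‖ ≈ ⟨ x , x ⟩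
  ‖x‖²≈⟨x,x⟩ x = √-square (⟨x,x⟩-nonneg x)

  ‖‖-cong : ∀ {d} {x y : Point d} → (∀ i → x i ≈ y i) → ‖ x ‖ ≈ ‖ y ‖
  ‖‖-cong x≈y = √-cong (sum-cong-≋ λ i → *-cong (x≈y i) (x≈y i))

  -- The two-dimensional case carries the induction step, so no vector has to
  -- be divided by its norm.
  cauchy-schwarz : ∀ {d} (x y : Point d) → ⟨ x , y ⟩ ≤ ‖ x ‖ * ‖ y ‖
  cauchy-schwarz {ℕ.zero}  x y = *-nonneg (‖x‖-nonneg x) (‖x‖-nonneg y)
  cauchy-schwarz {ℕ.suc d} x y = begin
    u * v + ⟨ x ∘ suc , y ∘ suc ⟩  ≤⟨ +-monoʳ-≤ (u * v) (cauchy-schwarz (x ∘ suc) (y ∘ suc)) ⟩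
    u * v + a * b                  ≤⟨ square-cancel-≤ (*-nonneg (‖x‖-nonneg x) (‖x‖-nonneg y)) squares ⟩
    ‖ x ‖ * ‖ y ‖                  ∎
    where
    u = x zero
    v = y zero
    a = ‖ x ∘ suc ‖
    b = ‖ y ∘ suc ‖

    -- Cauchy-Schwarz in the plane for (u, a) and (v, b). The cross term is twice the product of ub
    -- and va, and replacing it by the sum of their squares completes (u² + a²)(v² + b²).
    squares : (u * v + a * b) * (u * v + a * b) ≤ ‖ x ‖ * ‖ y ‖ * (‖ x ‖ * ‖ y ‖)
    squares = begin
      (u * v + a * b) * (u * v + a * b)
        ≈⟨ solve 4 (λ u v a b → (u :* v :+ a :* b) :* (u :* v :+ a :* b)
             := (u :* u) :* (v :* v) :+ (a :* a) :* (b :* b) :+ ((u :* b) :* (v :* a) :+ (u :* b) :* (v :* a))) refl u v a b ⟩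
      (u * u) * (v * v) + (a * a) * (b * b) + ((u * b) * (v * a) + (u * b) * (v * a))
        ≤⟨ +-monoʳ-≤ _ (2xy≤x²+y² (u * b) (v * a)) ⟩
      (u * u) * (v * v) + (a * a) * (b * b) + ((u * b) * (u * b) + (v * a) * (v * a))
        ≈⟨ solve 4 (λ u v a b → (u :* u) :* (v :* v) :+ (a :* a) :* (b :* b) :+ ((u :* b) :* (u :* b) :+ (v :* a) :* (v :* a))
             := (u :* u :+ a :* a) :* (v :* v :+ b :* b)) refl u v a b ⟩
      (u * u + a * a) * (v * v + b * b)
        ≈⟨ *-cong (+-congˡ (‖x‖²≈⟨x,x⟩ (x ∘ suc))) (+-congˡ (‖x‖²≈⟨x,x⟩ (y ∘ suc))) ⟩
      ⟨ x , x ⟩ * ⟨ y , y ⟩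
        ≈⟨ *-cong (‖x‖²≈⟨x,x⟩ x) (‖x‖²≈⟨x,x⟩ y) ⟨
      ‖ x ‖ * ‖ x ‖ * (‖ y ‖ * ‖ y ‖)
        ≈⟨ solve 2 (λ p q → p :* p :* (q :* q) := p :* q :* (p :* q)) refl ‖ x ‖ ‖ y ‖ ⟩
      ‖ x ‖ * ‖ y ‖ * (‖ x ‖ * ‖ y ‖) ∎

  _⊕_ : ∀ {d} → Point d → Point d → Point d
  (x ⊕ y) i = x i + y i

  ⟨x⊕y,x⊕y⟩ : ∀ {d} (x y : Point d) →
    ⟨ x ⊕ y , x ⊕ y ⟩ ≈ ⟨ x , x ⟩ + ⟨ y , y ⟩ + (⟨ x , y ⟩ + ⟨ x , y ⟩)
  ⟨x⊕y,x⊕y⟩ {ℕ.zero}  x y = sym (trans (+-congʳ (+-identityʳ 0#)) (trans (+-identityˡ _) (+-identityˡ 0#)))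
  ⟨x⊕y,x⊕y⟩ {ℕ.suc d} x y = trans (+-congˡ (⟨x⊕y,x⊕y⟩ (x ∘ suc) (y ∘ suc)))
    (solve 5 (λ u v p q r → (u :+ v) :* (u :+ v) :+ (p :+ q :+ (r :+ r))
       := u :* u :+ p :+ (v :* v :+ q) :+ (u :* v :+ r :+ (u :* v :+ r))) refl
       (x zero) (y zero) _ _ _)

  -- After squaring, the two sides differ only in the cross term, which Cauchy-Schwarz bounds.
  ‖x⊕y‖≤‖x‖+‖y‖ : ∀ {d} (x y : Point d) → ‖ x ⊕ y ‖ ≤ ‖ x ‖ + ‖ y ‖
  ‖x⊕y‖≤‖x‖+‖y‖ x y = square-cancel-≤ (+-nonneg (‖x‖-nonneg x) (‖x‖-nonneg y)) (begin
    ‖ x ⊕ y ‖ * ‖ x ⊕ y ‖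
      ≈⟨ ‖x‖²≈⟨x,x⟩ (x ⊕ y) ⟩
    ⟨ x ⊕ y , x ⊕ y ⟩
      ≈⟨ ⟨x⊕y,x⊕y⟩ x y ⟩
    ⟨ x , x ⟩ + ⟨ y , y ⟩ + (⟨ x , y ⟩ + ⟨ x , y ⟩)
      ≤⟨ +-monoʳ-≤ _ (+-mono-≤ (cauchy-schwarz x y) (cauchy-schwarz x y)) ⟩
    ⟨ x , x ⟩ + ⟨ y , y ⟩ + (‖ x ‖ * ‖ y ‖ + ‖ x ‖ * ‖ y ‖)
      ≈⟨ +-congʳ (+-cong (‖x‖²≈⟨x,x⟩ x) (‖x‖²≈⟨x,x⟩ y)) ⟨
    ‖ x ‖ * ‖ x ‖ + ‖ y ‖ * ‖ y ‖ + (‖ x ‖ * ‖ y ‖ + ‖ x ‖ * ‖ y ‖)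
      ≈⟨ solve 2 (λ p q → p :* p :+ q :* q :+ (p :* q :+ p :* q) := (p :+ q) :* (p :+ q)) refl ‖ x ‖ ‖ y ‖ ⟩
    (‖ x ‖ + ‖ y ‖) * (‖ x ‖ + ‖ y ‖) ∎)

  dist-triangle : ∀ {d} (x y z : Point d) → dist x z ≤ dist x y + dist y z
  dist-triangle x y z = begin
    dist x z                  ≈⟨ ‖‖-cong (λ i → telescope (x i) (y i) (z i)) ⟩
    ‖ (x − y) ⊕ (y − z) ‖     ≤⟨ ‖x⊕y‖≤‖x‖+‖y‖ (x − y) (y − z) ⟩
    dist x y + dist y z       ∎
    where
    telescope : ∀ a b c → a - c ≈ (a - b) + (b - c)
    telescope a b c = begin-equality
      -- The solver works over semirings and takes negated terms as atoms, so the cancellation of b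
      -- is done by hand before regrouping.
      a - c                 ≈⟨ +-congʳ (x+[y-x]≈y b a) ⟨
      b + (a - b) - c       ≈⟨ solve 3 (λ b p n → b :+ p :+ n := p :+ (b :+ n)) refl b (a - b) (- c) ⟩
      (a - b) + (b - c)     ∎

  dist-sym : ∀ {d} (x y : Point d) → dist x y ≈ dist y x
  dist-sym x y = √-cong (sum-cong-≋ λ i → trans (*-cong (flip i) (flip i)) (-x*-x≈x*x (y i - x i)))
    where
    flip : ∀ i → x i - y i ≈ - (y i - x i)
    flip i = sym (⁻¹-anti-homo‿- (y i) (x i))

  -- Norms are read as distances to this point, so that the triangle inequality for `dist` covers
  -- them too.
  origin : ∀ {d} → Point d
  origin _ = 0#

  dist-origin : ∀ {d} (x : Point d) → dist x origin ≈ ‖ x ‖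
  dist-origin x = ‖‖-cong λ i → trans (+-congˡ -0#≈0#) (+-identityʳ (x i))

  -- Carries the bound from the centred points back to the given ones.
  dist-translate : ∀ {d} (x y v : Point d) → dist (x − v) (y − v) ≈ dist x y
  dist-translate x y v = ‖‖-cong λ i → begin-equality
    (x i - v i) - (y i - v i)         ≈⟨ +-congˡ (⁻¹-anti-homo‿- (y i) (v i)) ⟩
    (x i - v i) + (v i - y i)         ≈⟨ solve 4 (λ x v w y → x :+ w :+ (v :+ y) := x :+ y :+ (v :+ w)) refl (x i) (v i) (- v i) (- y i) ⟩
    (x i - y i) + (v i - v i)         ≈⟨ +-congˡ (-‿inverseʳ (v i)) ⟩
    (x i - y i) + 0#                  ≈⟨ +-identityʳ _ ⟩
    x i - y i                         ∎

-- Sizes of finite subsets.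

-- The search through `Fin n` is decidable, and its failure would give q ⊆ p. It supplies the next
-- element of a growing selection and, with p empty, an element of a table.
∣p∣<∣q∣⇒∃∈q∉p : ∀ {n} (p q : Subset n) → ∣ p ∣ ℕ.< ∣ q ∣ → ∃ λ x → x ∈ q × x ∉ p
∣p∣<∣q∣⇒∃∈q∉p p q ∣p∣<∣q∣ with any? (λ x → x ∈? q ×-dec ¬? (x ∈? p))
... | yes found = found
... | no ¬found = contradiction (p⊆q⇒∣p∣≤∣q∣ q⊆p) (ℕ.<⇒≱ ∣p∣<∣q∣)
  where
  q⊆p : q ⊆ p
  q⊆p {x} x∈q = decidable-stable (x ∈? p) λ x∉p → ¬found (x , x∈q , x∉p)

x∉p⇒∣⁅x⁆∪p∣≡1+∣p∣ : ∀ {n x} {p : Subset n} → x ∉ p → ∣ ⁅ x ⁆ ∪ p ∣ ≡ ℕ.suc ∣ p ∣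
x∉p⇒∣⁅x⁆∪p∣≡1+∣p∣ {x = zero}  {inside  ∷ p} x∉p = contradiction here x∉p
x∉p⇒∣⁅x⁆∪p∣≡1+∣p∣ {x = zero}  {outside ∷ p} x∉p = cong (ℕ.suc ∘ ∣_∣) (∪-identityˡ p)
x∉p⇒∣⁅x⁆∪p∣≡1+∣p∣ {x = suc x} {inside  ∷ p} x∉p = cong ℕ.suc (x∉p⇒∣⁅x⁆∪p∣≡1+∣p∣ (x∉p ∘ there))
x∉p⇒∣⁅x⁆∪p∣≡1+∣p∣ {x = suc x} {outside ∷ p} x∉p = x∉p⇒∣⁅x⁆∪p∣≡1+∣p∣ (x∉p ∘ there)

-- Choosing elements with the largest values.

module Selection {c ℓ} (ℝ : RealNumbers c ℓ) {n : ℕ} (f : Fin n → RealNumbers.Carrier ℝ) where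
  open RealNumbers ℝ using (_≤_; totalOrder; IsArgmax)
  open Extrema totalOrder using (argmax; argmax-all; f[xs]≤f[argmax])

  ∃-argmax : ∀ {p} {P : Pred (Fin n) p} → Decidable P → Satisfiable P → ∃ (IsArgmax f P)
  ∃-argmax P? (x , Px) =
    -- The witness x serves as the default of `argmax`, so the result satisfies P whether it is the
    -- default or a listed candidate.
    argmax f x candidates ,
    argmax-all f Px (all-filter P? (allFin n)) ,
    λ y Py → lookup (f[xs]≤f[argmax] x candidates) (∈-filter⁺ P? (∈-allFin y) Py)
    where candidates = filter P? (allFin n)

  IsTop : Subset n → Subset n → Set ℓ
  IsTop U R = ∀ {r s} → r ∈ R → s ∈ U → s ∉ R → f s ≤ f r

  -- Greedy choice: a best remaining element x joins the selection R. Elements outside the enlarged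
  -- set were already outside R, so both x and the members of R dominate them.
  ∃-top : ∀ (U : Subset n) k → k ℕ.≤ ∣ U ∣ → ∃ λ R → R ⊆ U × ∣ R ∣ ≡ k × IsTop U R
  ∃-top U ℕ.zero k≤∣U∣ =
    ⊥ , (λ x∈⊥ → contradiction x∈⊥ ∉⊥) , ∣⊥∣≡0 n , λ r∈⊥ → contradiction r∈⊥ ∉⊥
  ∃-top U (ℕ.suc k) k<∣U∣ with ∃-top U k (ℕ.<⇒≤ k<∣U∣)
  -- Matching on `≡-refl` replaces k by ∣ R ∣, so `k<∣U∣` now says that R is smaller than U.
  ... | R , R⊆U , ≡-refl , top
    with ∃-argmax (λ x → x ∈? U ×-dec ¬? (x ∈? R)) (∣p∣<∣q∣⇒∃∈q∉p R U k<∣U∣)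
  ... | x , (x∈U , x∉R) , x-max = ⁅ x ⁆ ∪ R , R′⊆U , x∉p⇒∣⁅x⁆∪p∣≡1+∣p∣ x∉R , top′
    where
    R′⊆U : ⁅ x ⁆ ∪ R ⊆ U
    R′⊆U y∈R′ with x∈p∪q⁻ ⁅ x ⁆ R y∈R′
    ... | inj₁ y∈⁅x⁆ rewrite x∈⁅y⁆⇒x≡y x y∈⁅x⁆ = x∈U
    ... | inj₂ y∈R = R⊆U y∈R

    top′ : IsTop U (⁅ x ⁆ ∪ R)
    top′ {r} {s} r∈R′ s∈U s∉R′ with x∈p∪q⁻ ⁅ x ⁆ R r∈R′
    ... | inj₁ r∈⁅x⁆ rewrite x∈⁅y⁆⇒x≡y x r∈⁅x⁆ = x-max s (s∈U , s∉R′ ∘ q⊆p∪q ⁅ x ⁆ R)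
    ... | inj₂ r∈R = top r∈R s∈U (s∉R′ ∘ q⊆p∪q ⁅ x ⁆ R)

-- Existence of executions and the approximation bound for centred points.

module DrusillaHashProperties
  {c ℓ} (ℝ : RealNumbers c ℓ) {d n q : ℕ}
  (Sᵣ : Fin n → Euclidean.Point ℝ d) (S_q : Fin q → Euclidean.Point ℝ d)
  (ε : RealNumbers.Carrier ℝ) (m : ℕ)
  where

  open RealNumbers ℝ hiding (zero)
  open Euclidean ℝ
  open OrderedFieldProperties ℝ
  open EuclideanProperties ℝ
  open Selection ℝ
  open GuaranteedDrusillaHash ℝ Sᵣ S_q ε m
  open Extrema totalOrder using (max≤v⁺; ⊥≤max)
  open StrictReasoning strictPartialOrder hiding (stop)

  loopCondition? : ∀ U → Dec (LoopCondition U)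
  loopCondition? U = any? λ r → r ∈? U ×-dec δ * M <? ‖ reference r ‖

  ∃-table : ∀ U → Nonempty U → ∃ (IsTable U)
  ∃-table U U≢∅ with ∃-argmax (λ r → ‖ reference r ‖) (_∈? U) U≢∅
  ... | base , largest with ∃-top (score (direction base)) U (m ℕ.⊓ ∣ U ∣) (ℕ.m⊓n≤n m ∣ U ∣)
  ... | R , R⊆U , size , top = R , record
    { base = base ; largest = largest ; R⊆ = R⊆U ; size = size ; top = top }

  -- Makes the loop terminate. Both m and ∣ U ∣ are positive, hence so is their minimum ∣ R ∣, and
  -- an element of R is removed from U.
  table-shrinks : .{{_ : NonZero m}} → ∀ {U R} → Nonempty U → IsTable U R → ∣ U ─ R ∣ ℕ.< ∣ U ∣
  table-shrinks {U} {R} (r , r∈U) table = p∩q≢∅⇒∣p─q∣<∣p∣ U R U∩R≢∅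
    where
    open IsTable table

    0<∣U∣ : 0 ℕ.< ∣ U ∣
    0<∣U∣ = ℕ.≤-<-trans ℕ.z≤n (x∈p⇒∣p-x∣<∣p∣ r∈U)

    ∣⊥∣<∣R∣ : ∣ ⊥ {n} ∣ ℕ.< ∣ R ∣
    ∣⊥∣<∣R∣ = subst₂ ℕ._<_ (≡-sym (∣⊥∣≡0 n)) (≡-sym size) (ℕ.⊓-pres-m< (ℕ.>-nonZero⁻¹ m) 0<∣U∣)

    U∩R≢∅ : Nonempty (U ∩ R)
    U∩R≢∅ with ∣p∣<∣q∣⇒∃∈q∉p ⊥ R ∣⊥∣<∣R∣
    ... | x , x∈R , _ = x , x∈p∩q⁺ (R⊆ x∈R , x∈R)

  ∃-loop : .{{_ : NonZero m}} → ∀ U → Acc ℕ._<_ ∣ U ∣ → ∃ λ Rs → ∃ (Loop U Rs)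
  ∃-loop U (acc rec) with loopCondition? U
  ... | no ¬cond = [] , U , stop ¬cond
  ... | yes cond@(r , r∈U , _) with ∃-table U (r , r∈U)
  ... | R , table with ∃-loop (U ─ R) (rec (table-shrinks (r , r∈U) table))
  ... | Rs , L , loop = R ∷ Rs , L , step cond table loop

  ∃-shrug : ∀ L → ∃ (IsShrugPoint L)
  ∃-shrug L with nonempty? L
  ... | yes (r , r∈L) = just r , some r∈L
  ... | no L≡∅ = nothing , none L≡∅

  tabled⊎leftover : ∀ {U Rs L r} → Loop U Rs L → r ∈ U → Any (r ∈_) Rs ⊎ r ∈ L
  tabled⊎leftover (stop _) r∈U = inj₂ r∈U
  tabled⊎leftover {r = r} (step {R = R} _ _ loop) r∈U with r ∈? R
  ... | yes r∈R = inj₁ (here r∈R)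
  ... | no r∉R = map₁ there (tabled⊎leftover loop (x∈p∧x∉q⇒x∈p─q r∈U r∉R))

  leftover-small : ∀ {U Rs L r} → Loop U Rs L → r ∈ L → ‖ reference r ‖ ≤ δ * M
  leftover-small (stop ¬cond) r∈L = ≮⇒≥ λ δM<r → ¬cond (_ , r∈L , δM<r)
  leftover-small (step _ _ loop) r∈L = leftover-small loop r∈L

  -- The search needs something to maximise over. Without a shrug point nothing is left over, so the
  -- first reference point lies in a table.
  ∃-candidate : .{{_ : NonZero n}} → ∀ {Rs L shrug} → Loop ⊤ Rs L → IsShrugPoint L shrug →
    ∃ λ r → Any (r ∈_) Rs ⊎ shrug ≡ just r
  ∃-candidate loop (some _) = _ , inj₂ ≡-refl
  ∃-candidate loop (none L≡∅) with tabled⊎leftover loop (∈⊤ {x = fromℕ< (ℕ.>-nonZero⁻¹ n)})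
  ... | inj₁ tabled = _ , inj₁ tabled
  ... | inj₂ r∈L = contradiction (_ , r∈L) L≡∅

  execution : .{{_ : NonZero n}} .{{_ : NonZero m}} → Execution
  execution with ∃-loop ⊤ (<-wellFounded _)
  ... | Rs , L , loop with ∃-shrug L
  ... | shrug , isShrug = record
    { tables = Rs ; leftover = L ; loop = loop ; shrug = shrug ; isShrug = isShrug
    ; result = proj₁ ∘ search ; search = proj₂ ∘ search }
    where
    candidate? : Decidable (λ r → Any (r ∈_) Rs ⊎ shrug ≡ just r)
    candidate? r = Any.any? (r ∈?_) Rs ⊎-dec ≡-dec _≟_ shrug (just r)

    search : ∀ j → ∃ (IsArgmax (λ r → dist (query j) (reference r)) _)
    search j = ∃-argmax _ candidate? (∃-candidate loop isShrug)

  module _ (run : Execution) (j : Fin q) where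
    open Execution run

    private
      D : Carrier
      D = dist (query j) (reference (result j))

      candidate-≤ : ∀ {r} → Candidate r → dist (query j) (reference r) ≤ D
      candidate-≤ = proj₂ (search j) _

    shrug-of : ∀ {r} → r ∈ leftover →
      ∃ λ s → dist (query j) (reference s) ≤ D × ‖ reference s ‖ ≤ δ * M
    shrug-of r∈L = go isShrug ≡-refl
      where
      -- The field `shrug` is generalised to a variable x, so that `isShrug` can be matched on while
      -- the equation remembers the link.
      go : ∀ {x} → IsShrugPoint leftover x → shrug ≡ x →
        ∃ λ s → dist (query j) (reference s) ≤ D × ‖ reference s ‖ ≤ δ * M
      go (none L≡∅) _ = contradiction (_ , r∈L) L≡∅
      go (some s∈L) eq = _ , candidate-≤ (inj₂ eq) , leftover-small loop s∈L

    approximate : 0# < ε → ε < 1# → ∀ fn →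
      0# < dist (query j) (reference fn) →
      0# < D × dist (query j) (reference fn) < (1# + ε) * D
    approximate 0<ε ε<1 fn 0<d with tabled⊎leftover loop (∈⊤ {x = fn})
    -- A tabled fn competes in the search, so its distance is at most D. This makes D positive, and
    -- the extra ε * D gives strictness.
    ... | inj₁ tabled = 0<D , (begin-strict
        dist (query j) (reference fn) ≤⟨ d≤D ⟩
        D                             ≈⟨ *-identityˡ D ⟨
        1# * D                        ≈⟨ +-identityʳ _ ⟨
        1# * D + 0#                   <⟨ +-monoʳ-< _ (*-pos 0<ε 0<D) ⟩
        1# * D + ε * D                ≈⟨ distribʳ D 1# ε ⟨
        (1# + ε) * D                  ∎)
      where
      d≤D = candidate-≤ (inj₁ tabled)

      0<D : 0# < D
      0<D = begin-strict
        0#                            <⟨ 0<d ⟩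
        dist (query j) (reference fn) ≤⟨ d≤D ⟩
        D                             ∎
    ... | inj₂ fn∈L with shrug-of fn∈L
    ... | s , ds≤D , s≤δM = ratio-arithmetic 0<ε ε<1 (⊥≤max 0# (tabulate λ r → ‖ reference r ‖)) 0<d M≤ d≤
      where
      0≤D : 0# ≤ D
      0≤D = ‖x‖-nonneg (query j − reference (result j))

      -- M is the maximum of a list, so it is bounded by bounding every entry instead of by picking
      -- a point that attains it.
      norm≤ : ∀ r → ‖ reference r ‖ ≤ D + D + δ * M
      norm≤ r with tabled⊎leftover loop (∈⊤ {x = r})
      ... | inj₁ tabled = begin
        ‖ reference r ‖                                   ≈⟨ dist-origin (reference r) ⟨
        dist (reference r) origin                         ≤⟨ dist-triangle (reference r) (reference s) origin ⟩
        dist (reference r) (reference s) + dist (reference s) origin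
          ≤⟨ +-mono-≤ (dist-triangle (reference r) (query j) (reference s)) (≤-reflexive (dist-origin (reference s))) ⟩
        dist (reference r) (query j) + dist (query j) (reference s) + ‖ reference s ‖
          ≤⟨ +-mono-≤ (+-mono-≤ (≤-trans (≤-reflexive (dist-sym (reference r) (query j))) (candidate-≤ (inj₁ tabled))) ds≤D) s≤δM ⟩
        D + D + δ * M                                     ∎
      ... | inj₂ r∈L = begin
        ‖ reference r ‖       ≤⟨ leftover-small loop r∈L ⟩
        δ * M                 ≈⟨ +-identityˡ (δ * M) ⟨
        0# + δ * M            ≤⟨ +-monoˡ-≤ (δ * M) (+-nonneg 0≤D 0≤D) ⟩
        D + D + δ * M         ∎

      M≤ : M ≤ D + D + δ * M
      -- The base value 0# of the maximum must lie below the bound as well; it lies below the norm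
      -- of fn.
      M≤ = max≤v⁺ (≤-trans (‖x‖-nonneg (reference fn)) (norm≤ fn)) (tabulate⁺ norm≤)

      d≤ : dist (query j) (reference fn) ≤ D + (δ * M + δ * M)
      d≤ = begin
        dist (query j) (reference fn)
          ≤⟨ dist-triangle (query j) (reference s) (reference fn) ⟩
        dist (query j) (reference s) + dist (reference s) (reference fn)
          ≤⟨ +-mono-≤ ds≤D (dist-triangle (reference s) origin (reference fn)) ⟩
        D + (dist (reference s) origin + dist origin (reference fn))
          ≈⟨ +-congˡ (+-cong (dist-origin (reference s)) (trans (dist-sym origin (reference fn)) (dist-origin (reference fn)))) ⟩
        D + (‖ reference s ‖ + ‖ reference fn ‖)
          ≤⟨ +-monoʳ-≤ D (+-mono-≤ s≤δM (leftover-small loop fn∈L)) ⟩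
        D + (δ * M + δ * M) ∎

-- The execution in the first component keeps the claim about all runs from being vacuous. The
-- denominator is shown to be positive because the value of `_⁻¹` at 0# is unspecified, so the
-- quotient alone would carry no meaning there.
theorem1 : ∀ {c ℓ} (ℝ : RealNumbers c ℓ) →
    let open RealNumbers ℝ
        open Euclidean ℝ
        open GuaranteedDrusillaHash ℝ using (Execution)
        open GuaranteedDrusillaHash.Execution using (result)
    in
    ∀ {d n q : ℕ} .{{_ : NonZero n}}
      (Sᵣ : Fin n → Point d) (S_q : Fin q → Point d)
      (ε : Carrier) → 0# < ε → ε < 1# →
      (m : ℕ) .{{_ : NonZero m}} →
      Execution Sᵣ S_q ε m ×
      ((run : Execution Sᵣ S_q ε m) (j : Fin q) (fn : Fin n) →
        IsFurthestNeighbour (S_q j) Sᵣ fn →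
        0# < dist (S_q j) (Sᵣ fn) →
        0# < dist (S_q j) (Sᵣ (result run j)) ×
        dist (S_q j) (Sᵣ fn) / dist (S_q j) (Sᵣ (result run j)) < 1# + ε)
theorem1 ℝ {n = n} Sᵣ S_q ε 0<ε ε<1 m = execution , bound
  where
  open RealNumbers ℝ hiding (zero)
  open Euclidean ℝ
  open OrderedFieldProperties ℝ
  open EuclideanProperties ℝ using (dist-translate)
  open DrusillaHashProperties ℝ Sᵣ S_q ε m
  open GuaranteedDrusillaHash ℝ Sᵣ S_q ε m
  open Execution using (result)
  open StrictReasoning strictPartialOrder

  bound : ∀ run j fn → IsFurthestNeighbour (S_q j) Sᵣ fn → 0# < dist (S_q j) (Sᵣ fn) →
    0# < dist (S_q j) (Sᵣ (result run j)) ×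
    dist (S_q j) (Sᵣ fn) / dist (S_q j) (Sᵣ (result run j)) < 1# + ε
  bound run j fn _ 0<d = 0<D , x<z*y⇒x/y<z 0<D (begin-strict
      dist (S_q j) (Sᵣ fn)                                    ≈⟨ centring fn ⟨
      dist (query j) (reference fn)                           <⟨ proj₂ approx ⟩
      (1# + ε) * dist (query j) (reference (result run j))    ≈⟨ *-congˡ (centring (result run j)) ⟩
      (1# + ε) * dist (S_q j) (Sᵣ (result run j))             ∎)
    where
    centring : ∀ r → dist (query j) (reference r) ≈ dist (S_q j) (Sᵣ r)
    centring r = dist-translate (S_q j) (Sᵣ r) (mean Sᵣ)

    approx = approximate run j 0<ε ε<1 fn (begin-strict
      0#                            <⟨ 0<d ⟩
      dist (S_q j) (Sᵣ fn)          ≈⟨ centring fn ⟨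
      dist (query j) (reference fn) ∎)

    0<D : 0# < dist (S_q j) (Sᵣ (result run j))
    0<D = begin-strict
      0#                                        <⟨ proj₁ approx ⟩
      dist (query j) (reference (result run j)) ≈⟨ centring (result run j) ⟩
      dist (S_q j) (Sᵣ (result run j))          ∎
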